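{- Let $f$ be an endomorphism of the monoid $\mathcal P_{\mathrm{fin},0}(\mathbb N)$. The following are equivalent: (a) $f$ is injective and $f(\{0,1\}) = \{0,1\}$. (b) $f$ is surjective. (c) $f$ is an automorphism.
   Context: $\mathbb N$ denotes the set of non-negative integers. $\mathcal P_{\mathrm{fin},0}(\mathbb N)$ is the set of all finite subsets of $\mathbb N$ containing $0$, made into a commutative monoid by the sumset operation $X + Y := \{x + y : x \in X,\ y \in Y\}$; its neutral element is $\{0\}$. An endomorphism is a monoid homomorphism from the monoid to itself; an automorphism is a bijective endomorphism. -}

module Defs where

open import Algebra.Bundles using (CommutativeMonoid)
open import Algebra.Morphism.Structures using (module MonoidMorphisms)
open import Data.List.Base using (List; []; _∷_; cartesianProductWith)
open import Data.List.Membership.Propositional using (_∈_)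
open import Data.List.Membership.Propositional.Properties
  using (∈-cartesianProductWith⁺; ∈-cartesianProductWith⁻)
open import Data.List.Relation.Binary.BagAndSetEquality using (_∼[_]_; set; [_]-Equality)
open import Data.List.Relation.Unary.Any using (here)
open import Data.Nat.Base using (ℕ; _+_)
open import Data.Nat.Properties using (+-assoc; +-comm)
open import Data.Product using (_,_; _×_; ∃₂)
open import Function.Bundles using (mk⇔; Equivalence)
open import Level using (0ℓ)
open import Relation.Binary.Bundles using (Setoid)
open import Relation.Binary.PropositionalEquality using (_≡_; refl; sym; subst)

-- A finite subset of ℕ is given by a list enumerating it, in any order and
-- possibly with repetitions; the equality on 𝒫fin,0 is _≈_ below, not _≡_.
record 𝒫fin,0 : Set where
  constructor ⟨_,_⟩
  field
    elements : List ℕ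
    0∈       : 0 ∈ elements

open 𝒫fin,0 public

infix 4 _≈_
infixl 6 _⊕_

_≈_ : 𝒫fin,0 → 𝒫fin,0 → Set
X ≈ Y = elements X ∼[ set ] elements Y

_⊕_ : 𝒫fin,0 → 𝒫fin,0 → 𝒫fin,0
X ⊕ Y = ⟨ cartesianProductWith _+_ (elements X) (elements Y)
        , ∈-cartesianProductWith⁺ _+_ (0∈ X) (0∈ Y) ⟩

⟦0⟧ : 𝒫fin,0
⟦0⟧ = ⟨ 0 ∷ [] , here refl ⟩

⟦0,1⟧ : 𝒫fin,0
⟦0,1⟧ = ⟨ 0 ∷ 1 ∷ [] , here refl ⟩

∈-⊕⁺ : ∀ X Y {x y} → x ∈ elements X → y ∈ elements Y → x + y ∈ elements (X ⊕ Y)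
∈-⊕⁺ _ _ = ∈-cartesianProductWith⁺ _+_

∈-⊕⁻ : ∀ X Y {z} → z ∈ elements (X ⊕ Y) →
       ∃₂ λ x y → x ∈ elements X × y ∈ elements Y × z ≡ x + y
∈-⊕⁻ X Y = ∈-cartesianProductWith⁻ _+_ (elements X) (elements Y)

private
  ⊕-mono : ∀ X X′ Y Y′ → X ≈ X′ → Y ≈ Y′ →
           ∀ {z} → z ∈ elements (X ⊕ Y) → z ∈ elements (X′ ⊕ Y′)
  ⊕-mono X X′ Y Y′ p q z∈ with ∈-⊕⁻ X Y z∈
  ... | _ , _ , x∈ , y∈ , refl = ∈-⊕⁺ X′ Y′ (Equivalence.to p x∈) (Equivalence.to q y∈)

  ⊕-assoc : ∀ X Y Z → (X ⊕ Y) ⊕ Z ≈ X ⊕ (Y ⊕ Z)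
  ⊕-assoc X Y Z = mk⇔ to from
    where
    to : ∀ {w} → w ∈ elements ((X ⊕ Y) ⊕ Z) → w ∈ elements (X ⊕ (Y ⊕ Z))
    to w∈ with ∈-⊕⁻ (X ⊕ Y) Z w∈
    ... | _ , z , xy∈ , z∈ , refl with ∈-⊕⁻ X Y xy∈
    ... | x , y , x∈ , y∈ , refl =
      subst (_∈ elements (X ⊕ (Y ⊕ Z))) (sym (+-assoc x y z))
        (∈-⊕⁺ X (Y ⊕ Z) x∈ (∈-⊕⁺ Y Z y∈ z∈))
    from : ∀ {w} → w ∈ elements (X ⊕ (Y ⊕ Z)) → w ∈ elements ((X ⊕ Y) ⊕ Z)
    from w∈ with ∈-⊕⁻ X (Y ⊕ Z) w∈
    ... | x , _ , x∈ , yz∈ , refl with ∈-⊕⁻ Y Z yz∈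
    ... | y , z , y∈ , z∈ , refl =
      subst (_∈ elements ((X ⊕ Y) ⊕ Z)) (+-assoc x y z)
        (∈-⊕⁺ (X ⊕ Y) Z (∈-⊕⁺ X Y x∈ y∈) z∈)

  ⊕-comm-⊆ : ∀ X Y {z} → z ∈ elements (X ⊕ Y) → z ∈ elements (Y ⊕ X)
  ⊕-comm-⊆ X Y z∈ with ∈-⊕⁻ X Y z∈
  ... | x , y , x∈ , y∈ , refl =
    subst (_∈ elements (Y ⊕ X)) (+-comm y x) (∈-⊕⁺ Y X y∈ x∈)

  ⊕-comm : ∀ X Y → X ⊕ Y ≈ Y ⊕ X
  ⊕-comm X Y = mk⇔ (⊕-comm-⊆ X Y) (⊕-comm-⊆ Y X)

  ⊕-identityˡ : ∀ X → ⟦0⟧ ⊕ X ≈ X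
  ⊕-identityˡ X = mk⇔ to (∈-⊕⁺ ⟦0⟧ X (here refl))
    where
    to : ∀ {z} → z ∈ elements (⟦0⟧ ⊕ X) → z ∈ elements X
    to z∈ with ∈-⊕⁻ ⟦0⟧ X z∈
    ... | _ , _ , here refl , x∈ , refl = x∈

  module S = Setoid ([ set ]-Equality ℕ)

  ≈-trans : ∀ {X Y Z} → X ≈ Y → Y ≈ Z → X ≈ Z
  ≈-trans {X} {Y} {Z} = S.trans {elements X} {elements Y} {elements Z}

  ≈-sym : ∀ {X Y} → X ≈ Y → Y ≈ X
  ≈-sym {X} {Y} = S.sym {elements X} {elements Y}

𝒫fin,0-commutativeMonoid : CommutativeMonoid 0ℓ 0ℓ
𝒫fin,0-commutativeMonoid = record
  { Carrier = 𝒫fin,0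
  ; _≈_     = _≈_
  ; _∙_     = _⊕_
  ; ε       = ⟦0⟧
  ; isCommutativeMonoid = record
    { isMonoid = record
      { isSemigroup = record
        { isMagma = record
          { isEquivalence = record
            { refl  = λ {X} → S.refl {elements X}
            ; sym   = λ {X} {Y} → ≈-sym {X} {Y}
            ; trans = λ {X} {Y} {Z} → ≈-trans {X} {Y} {Z}
            }
          ; ∙-cong = λ {X} {X′} {Y} {Y′} p q →
              mk⇔ (⊕-mono X X′ Y Y′ p q)
                  (⊕-mono X′ X Y′ Y (≈-sym {X} {X′} p) (≈-sym {Y} {Y′} q))
          }
        ; assoc = ⊕-assoc
        }
      ; identity = ⊕-identityˡ , λ X →
          ≈-trans {X ⊕ ⟦0⟧} {⟦0⟧ ⊕ X} {X} (⊕-comm X ⟦0⟧) (⊕-identityˡ X)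
      }
    ; comm = ⊕-comm
    }
  }

open CommutativeMonoid 𝒫fin,0-commutativeMonoid public using (rawMonoid)

-- Being a homomorphism includes respecting _≈_, so an endomorphism is a
-- well-defined map on finite sets rather than on their enumerations.
IsEndomorphism : (𝒫fin,0 → 𝒫fin,0) → Set
IsEndomorphism = MonoidMorphisms.IsMonoidHomomorphism rawMonoid rawMonoid

IsAutomorphism : (𝒫fin,0 → 𝒫fin,0) → Set
IsAutomorphism = MonoidMorphisms.IsMonoidIsomorphism rawMonoid rawMonoid

{-# OPTIONS --safe #-}

-- Let m = max X and let [0,n] be the n-fold sum of {0,1}. As X + [0,m] = [0,2m]
-- and maxima are additive, every endomorphism f satisfies
-- max f(X) = max X · max f({0,1}). Either (a) or (b) forces max f({0,1}) = 1, so
-- f preserves maxima. It therefore acts on the finite collection of sets with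
-- maximum at most m, where injectivity and surjectivity are equivalent.
module Submission where

open import Defs
open import Algebra.Bundles using (CommutativeMonoid)
open import Algebra.Morphism.Structures using (module MonoidMorphisms)
open import Data.Bool.Base using (if_then_else_)
open import Data.Fin.Base using (Fin; zero; suc; toℕ; fromℕ<; punchOut; combine; funToFin; finToFun)
import Data.Fin.Properties as Fin
open import Data.List.Base using (_∷_; map; filter; allFin)
open import Data.List.Extrema.Nat using (max; xs≤max; max≈v⁺; argmax-sel)
open import Data.List.Membership.Propositional using (_∈_)
open import Data.List.Membership.Propositional.Properties
  using (∈-allFin; ∈-map∘filter⁺; ∈-map∘filter⁻)
import Data.List.Relation.Unary.All as All
open import Data.List.Relation.Unary.Any using (here; there)
open import Data.Nat.Base using (ℕ; zero; suc; _+_; _*_; _^_; _⊔_; _≤_; _<_; z≤n; s≤s)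
open import Data.Nat.Properties using
  ( _≟_; ≤-refl; ≤-trans; ≤-total; +-mono-≤; +-cancelʳ-≡; *-distribʳ-+; *-identityʳ
  ; m+[n∸m]≡n; m≤n+o⇒m∸n≤o; m*n≡1⇒n≡1; m≤m⊔n; m≤n⊔m; n<1+n)
open import Data.List.Membership.DecPropositional _≟_ using (_∈?_)
open import Data.Product using (_×_; _,_; ∃; proj₁; proj₂)
open import Data.Sum.Base using (inj₁; inj₂)
open import Function.Base using (id; _∘_)
open import Function.Bundles using (_⇔_; mk⇔; Equivalence)
open import Function.Definitions using (Injective; Surjective; StrictlySurjective)
open import Relation.Binary.PropositionalEquality
  using (_≡_; _≗_; refl; sym; trans; cong; cong₂; subst; module ≡-Reasoning)
open import Relation.Nullary using (Dec; yes; no; does; contradiction)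

open CommutativeMonoid 𝒫fin,0-commutativeMonoid using (setoid) renaming (refl to ≈-refl)
import Relation.Binary.Reasoning.Setoid setoid as ≈-Reasoning

private
  variable
    m n : ℕ

-- Self-maps of finite types

-- Pigeonhole: if a value were missed, punching it out would leave an injection of `Fin (suc n)`
-- into `Fin n`.
injective⇒strictlySurjective : {g : Fin n → Fin n} →
  Injective _≡_ _≡_ g → StrictlySurjective _≡_ g
injective⇒strictlySurjective {n = suc n} {g} inj y with Fin.any? (λ x → g x Fin.≟ y)
... | yes hit = hit
... | no miss = contradiction
  (λ {i} {j} eq → inj (Fin.punchOut-injective (y≢ i) (y≢ j) eq))
  (Fin.<⇒notInjective {f = λ x → punchOut (y≢ x)} (n<1+n n))
  where
  y≢ : ∀ x → y ≡ g x → _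
  y≢ x y≡gx = miss (x , sym y≡gx)

-- A section of g is injective, hence surjective.
strictlySurjective⇒injective : {g : Fin n → Fin n} →
  StrictlySurjective _≡_ g → Injective _≡_ _≡_ g
strictlySurjective⇒injective {g = g} surj {x} {x′} gx≡gx′
  with injective⇒strictlySurjective {g = proj₁ ∘ surj} section-injective
  where
  section-injective : Injective _≡_ _≡_ (proj₁ ∘ surj)
  section-injective {a} {b} eq =
    trans (sym (proj₂ (surj a))) (trans (cong g eq) (proj₂ (surj b)))
... | section-surj with section-surj x | section-surj x′
-- Now `x` and `x′` are the values of the section at `a` and `b`. Since `g` undoes the section,
-- `g x ≡ g x′` yields `a ≡ b`.
... | a , refl | b , refl =
  cong (proj₁ ∘ surj) (trans (sym (proj₂ (surj a))) (trans gx≡gx′ (proj₂ (surj b))))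

-- Stands in for function extensionality, so that codes can be compared digit by digit.
funToFin-cong : {f g : Fin m → Fin n} → f ≗ g → funToFin f ≡ funToFin g
funToFin-cong {m = zero}  f≗g = refl
funToFin-cong {m = suc m} f≗g = cong₂ combine (f≗g zero) (funToFin-cong (f≗g ∘ suc))

-- Maxima

maximum : 𝒫fin,0 → ℕ
maximum X = max 0 (elements X)

∈⇒≤maximum : ∀ X {x} → x ∈ elements X → x ≤ maximum X
∈⇒≤maximum X = All.lookup (xs≤max 0 (elements X))

maximum∈ : ∀ X → maximum X ∈ elements X
maximum∈ X with argmax-sel id 0 (elements X)
-- The result is the base value `0` of `max`, which is itself an element of `X`.
... | inj₁ max≡0 = subst (_∈ elements X) (sym max≡0) (0∈ X)
... | inj₂ max∈  = max∈

maximum-unique : ∀ X → m ∈ elements X → (∀ {x} → x ∈ elements X → x ≤ m) → maximum X ≡ m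
maximum-unique X m∈ ≤m = max≈v⁺ m∈ (All.tabulate ≤m) z≤n

maximum-cong : ∀ X Y → X ≈ Y → maximum X ≡ maximum Y
maximum-cong X Y X≈Y = maximum-unique X (Equivalence.from X≈Y (maximum∈ Y))
  (λ x∈ → ∈⇒≤maximum Y (Equivalence.to X≈Y x∈))

maximum-⊕ : ∀ X Y → maximum (X ⊕ Y) ≡ maximum X + maximum Y
maximum-⊕ X Y = maximum-unique (X ⊕ Y) (∈-⊕⁺ X Y (maximum∈ X) (maximum∈ Y)) bound
  where
  bound : ∀ {z} → z ∈ elements (X ⊕ Y) → z ≤ maximum X + maximum Y
  bound z∈ with ∈-⊕⁻ X Y z∈
  ... | _ , _ , x∈ , y∈ , refl = +-mono-≤ (∈⇒≤maximum X x∈) (∈⇒≤maximum Y y∈)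

-- Serves to pass from the number `maximum (f ⟦0,1⟧)` to the set `f ⟦0,1⟧`: since `0` is always
-- present, a maximum of 1 leaves no choice.
maximum≡1⇒≈⟦0,1⟧ : ∀ X → maximum X ≡ 1 → X ≈ ⟦0,1⟧
maximum≡1⇒≈⟦0,1⟧ X max≡1 = mk⇔ to from
  where
  to : ∀ {x} → x ∈ elements X → x ∈ elements ⟦0,1⟧
  to {x} x∈ with x | subst (x ≤_) max≡1 (∈⇒≤maximum X x∈)
  ... | zero        | _ = here refl
  ... | suc zero    | _ = there (here refl)
  ... | suc (suc _) | s≤s ()
  from : ∀ {x} → x ∈ elements ⟦0,1⟧ → x ∈ elements X
  from (here refl)         = 0∈ X
  from (there (here refl)) = subst (_∈ elements X) max≡1 (maximum∈ X)

-- Intervals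

-- Built as an iterated sum, so that a homomorphism can be evaluated on it by induction.
⟦0⋯_⟧ : ℕ → 𝒫fin,0
⟦0⋯ zero  ⟧ = ⟦0⟧
⟦0⋯ suc n ⟧ = ⟦0,1⟧ ⊕ ⟦0⋯ n ⟧

∈-interval⁺ : ∀ n {z} → z ≤ n → z ∈ elements ⟦0⋯ n ⟧
∈-interval⁺ zero    z≤n        = here refl
∈-interval⁺ (suc n) z≤n        = 0∈ ⟦0⋯ suc n ⟧
∈-interval⁺ (suc n) (s≤s z≤n′) = ∈-⊕⁺ ⟦0,1⟧ ⟦0⋯ n ⟧ (there (here refl)) (∈-interval⁺ n z≤n′)

maximum-interval : ∀ n → maximum ⟦0⋯ n ⟧ ≡ n
maximum-interval zero    = refl
maximum-interval (suc n) =
  trans (maximum-⊕ ⟦0,1⟧ ⟦0⋯ n ⟧) (cong suc (maximum-interval n))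

∈-interval⁻ : ∀ n {z} → z ∈ elements ⟦0⋯ n ⟧ → z ≤ n
∈-interval⁻ n {z} z∈ = subst (z ≤_) (maximum-interval n) (∈⇒≤maximum ⟦0⋯ n ⟧ z∈)

-- The element `0` of `X` accounts for the lower half of the interval, the element `maximum X` for
-- the upper half.
⊕-interval : ∀ X → X ⊕ ⟦0⋯ maximum X ⟧ ≈ ⟦0⋯ maximum X + maximum X ⟧
⊕-interval X = mk⇔ to from
  where
  k = maximum X
  to : ∀ {z} → z ∈ elements (X ⊕ ⟦0⋯ k ⟧) → z ∈ elements ⟦0⋯ k + k ⟧
  to z∈ with ∈-⊕⁻ X ⟦0⋯ k ⟧ z∈
  ... | _ , _ , x∈ , y∈ , refl =
    ∈-interval⁺ (k + k) (+-mono-≤ (∈⇒≤maximum X x∈) (∈-interval⁻ k y∈))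
  from : ∀ {z} → z ∈ elements ⟦0⋯ k + k ⟧ → z ∈ elements (X ⊕ ⟦0⋯ k ⟧)
  from {z} z∈ with ≤-total z k
  ... | inj₁ z≤k = ∈-⊕⁺ X ⟦0⋯ k ⟧ (0∈ X) (∈-interval⁺ k z≤k)
  ... | inj₂ k≤z = subst (_∈ elements (X ⊕ ⟦0⋯ k ⟧)) (m+[n∸m]≡n k≤z)
    (∈-⊕⁺ X ⟦0⋯ k ⟧ (maximum∈ X)
      (∈-interval⁺ k (m≤n+o⇒m∸n≤o z k (∈-interval⁻ (k + k) z∈))))

-- Coding the sets of maximum at most m by Fin (2 ^ m)

bit : ∀ {A : Set} → Dec A → Fin 2
bit a? = if does a? then suc zero else zero

bit≡1⁺ : ∀ {A : Set} (a? : Dec A) → A → bit a? ≡ suc zero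
bit≡1⁺ (yes _) _ = refl
bit≡1⁺ (no ¬a) a = contradiction a ¬a

bit≡1⁻ : ∀ {A : Set} (a? : Dec A) → bit a? ≡ suc zero → A
bit≡1⁻ (yes a) _ = a

-- Reduces equality of codes to logical equivalences between membership conditions.
bit-unique : ∀ {A : Set} (a? : Dec A) (b : Fin 2) → A ⇔ (b ≡ suc zero) → bit a? ≡ b
bit-unique (yes a) b          A⇔ = sym (Equivalence.to A⇔ a)
bit-unique (no ¬a) zero       A⇔ = refl
bit-unique (no ¬a) (suc zero) A⇔ = contradiction (Equivalence.from A⇔ refl) ¬a

-- Bit i of a code records the membership of i + 1, since 0 is always a member.
bits : ∀ m → 𝒫fin,0 → Fin m → Fin 2
bits m X i = bit (suc (toℕ i) ∈? elements X)

-- Elements above `m` leave no trace in the code, whence the bound on `maximum X` in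
-- `decode-encode`.
encode : ∀ m → 𝒫fin,0 → Fin (2 ^ m)
encode m X = funToFin (bits m X)

bitSet? : ∀ m (c : Fin (2 ^ m)) (i : Fin m) → Dec (finToFun {2} {m} c i ≡ suc zero)
bitSet? m c i = finToFun {2} {m} c i Fin.≟ suc zero

decode : ∀ m → Fin (2 ^ m) → 𝒫fin,0
decode m c = ⟨ 0 ∷ map (suc ∘ toℕ) (filter (bitSet? m c) (allFin m)) , here refl ⟩

∈-decode⁺ : ∀ m c i → finToFun {2} {m} c i ≡ suc zero → suc (toℕ i) ∈ elements (decode m c)
∈-decode⁺ m c i cᵢ≡1 =
  there (∈-map∘filter⁺ (suc ∘ toℕ) (bitSet? m c) (i , ∈-allFin i , refl , cᵢ≡1))

∈-decode⁻ : ∀ m c {x} → suc x ∈ elements (decode m c) →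
            ∃ λ i → x ≡ toℕ i × finToFun {2} {m} c i ≡ suc zero
∈-decode⁻ m c (there x∈) with ∈-map∘filter⁻ (suc ∘ toℕ) (bitSet? m c) {xs = allFin m} x∈
... | i , _ , refl , cᵢ≡1 = i , refl , cᵢ≡1

maximum-decode : ∀ m c → maximum (decode m c) ≤ m
maximum-decode m c = bound (maximum∈ (decode m c))
  where
  bound : ∀ {x} → x ∈ elements (decode m c) → x ≤ m
  bound {zero}  _  = z≤n
  bound {suc x} x∈ with ∈-decode⁻ m c x∈
  -- The element is `suc (toℕ i)`, so the strict bound on the index is exactly what is needed.
  ... | i , refl , _ = Fin.toℕ<n i

encode-cong : ∀ m X Y → X ≈ Y → encode m X ≡ encode m Y
encode-cong m X Y X≈Y = funToFin-cong {m} λ i → bit-unique (suc (toℕ i) ∈? elements X) (bits m Y i)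
  (mk⇔ (λ x∈ → bit≡1⁺ (suc (toℕ i) ∈? elements Y) (Equivalence.to X≈Y x∈))
       (λ eq → Equivalence.from X≈Y (bit≡1⁻ (suc (toℕ i) ∈? elements Y) eq)))

encode-decode : ∀ m c → encode m (decode m c) ≡ c
encode-decode m c = trans
  (funToFin-cong {m} λ i → bit-unique (suc (toℕ i) ∈? elements (decode m c)) _
    (mk⇔ (from i) (∈-decode⁺ m c i)))
  (Fin.funToFin-finToFin {m} c)
  where
  from : ∀ i → suc (toℕ i) ∈ elements (decode m c) → finToFun {2} {m} c i ≡ suc zero
  from i i∈ with ∈-decode⁻ m c i∈
  ... | j , i≡j , cⱼ≡1 with refl ← Fin.toℕ-injective i≡j = cⱼ≡1

decode-injective : ∀ m c d → decode m c ≈ decode m d → c ≡ d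
decode-injective m c d eq = trans (sym (encode-decode m c))
  (trans (encode-cong m (decode m c) (decode m d) eq) (encode-decode m d))

decode-encode : ∀ m X → maximum X ≤ m → decode m (encode m X) ≈ X
decode-encode m X maxX≤m = mk⇔ to from
  where
  to : ∀ {x} → x ∈ elements (decode m (encode m X)) → x ∈ elements X
  to {zero}  _ = 0∈ X
  to {suc x} x∈ with ∈-decode⁻ m (encode m X) x∈
  ... | i , refl , cᵢ≡1 =
    bit≡1⁻ (_ ∈? elements X) (trans (sym (Fin.finToFun-funToFin (bits m X) i)) cᵢ≡1)
  from : ∀ {x} → x ∈ elements X → x ∈ elements (decode m (encode m X))
  from {zero}  _  = 0∈ (decode m (encode m X))
  from {suc x} x∈ = subst (λ y → suc y ∈ elements (decode m (encode m X))) (Fin.toℕ-fromℕ< x<m)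
    (∈-decode⁺ m (encode m X) i (trans (Fin.finToFun-funToFin (bits m X) i)
      (bit≡1⁺ (_ ∈? elements X)
        (subst (λ y → suc y ∈ elements X) (sym (Fin.toℕ-fromℕ< x<m)) x∈))))
    where
    x<m : x < m
    -- By definition `x < m` is `suc x ≤ m`, a bound on the element `suc x` whose bit has index `x`.
    x<m = ≤-trans (∈⇒≤maximum X x∈) maxX≤m
    i = fromℕ< x<m

-- Endomorphisms and maxima

module Endomorphism (f : 𝒫fin,0 → 𝒫fin,0) (f-endo : IsEndomorphism f) where

  open MonoidMorphisms.IsMonoidHomomorphism f-endo
    using (homo; ε-homo) renaming (⟦⟧-cong to f-cong)

  maximum-f-⊕ : ∀ X Y → maximum (f (X ⊕ Y)) ≡ maximum (f X) + maximum (f Y)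
  maximum-f-⊕ X Y = trans (maximum-cong (f (X ⊕ Y)) (f X ⊕ f Y) (homo X Y)) (maximum-⊕ (f X) (f Y))

  maximum-f-interval : ∀ n → maximum (f ⟦0⋯ n ⟧) ≡ n * maximum (f ⟦0,1⟧)
  maximum-f-interval zero    = maximum-cong (f ⟦0⟧) ⟦0⟧ ε-homo
  maximum-f-interval (suc n) = trans (maximum-f-⊕ ⟦0,1⟧ ⟦0⋯ n ⟧)
    (cong (maximum (f ⟦0,1⟧) +_) (maximum-f-interval n))

  -- The maximum of `f (X ⊕ ⟦0⋯ k ⟧)` is computed twice, by additivity and as that of the image of
  -- an interval; then `k * a` cancels.
  maximum-f : ∀ X → maximum (f X) ≡ maximum X * maximum (f ⟦0,1⟧)
  maximum-f X = +-cancelʳ-≡ (k * a) _ _ (begin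
    maximum (f X) + k * a
      ≡⟨ cong (maximum (f X) +_) (maximum-f-interval k) ⟨
    maximum (f X) + maximum (f ⟦0⋯ k ⟧)
      ≡⟨ maximum-f-⊕ X ⟦0⋯ k ⟧ ⟨
    maximum (f (X ⊕ ⟦0⋯ k ⟧))
      ≡⟨ maximum-cong (f (X ⊕ ⟦0⋯ k ⟧)) (f ⟦0⋯ k + k ⟧)
           (f-cong {X ⊕ ⟦0⋯ k ⟧} {⟦0⋯ k + k ⟧} (⊕-interval X)) ⟩
    maximum (f ⟦0⋯ k + k ⟧)
      ≡⟨ maximum-f-interval (k + k) ⟩
    (k + k) * a
      ≡⟨ *-distribʳ-+ a k k ⟩
    k * a + k * a ∎)
    where
    open ≡-Reasoning
    k = maximum X
    a = maximum (f ⟦0,1⟧)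

  surjective⇒preserves-⟦0,1⟧ : Surjective _≈_ _≈_ f → f ⟦0,1⟧ ≈ ⟦0,1⟧
  surjective⇒preserves-⟦0,1⟧ surj with surj ⟦0,1⟧
  -- As `f X ≈ ⟦0,1⟧`, the product `maximum X * maximum (f ⟦0,1⟧)` is 1, and so is each of its
  -- factors.
  ... | X , fX≈ = maximum≡1⇒≈⟦0,1⟧ (f ⟦0,1⟧) (m*n≡1⇒n≡1 (maximum X) _
    (trans (sym (maximum-f X)) (maximum-cong (f X) ⟦0,1⟧ (fX≈ {X} (≈-refl {X})))))

  -- Endomorphisms fixing `⟦0,1⟧`, as self-maps of finite sets of codes

  module _ (f⟦0,1⟧≈⟦0,1⟧ : f ⟦0,1⟧ ≈ ⟦0,1⟧) where

    f-preserves-maximum : ∀ X → maximum (f X) ≡ maximum X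
    f-preserves-maximum X = trans (maximum-f X)
      (trans (cong (maximum X *_) (maximum-cong (f ⟦0,1⟧) ⟦0,1⟧ f⟦0,1⟧≈⟦0,1⟧)) (*-identityʳ _))

    fCode : ∀ m → Fin (2 ^ m) → Fin (2 ^ m)
    fCode m = encode m ∘ f ∘ decode m

    -- Preservation of maxima keeps `f (decode m c)` within the range where encoding loses nothing.
    decode-fCode : ∀ m c → decode m (fCode m c) ≈ f (decode m c)
    decode-fCode m c = decode-encode m (f (decode m c))
      (subst (_≤ m) (sym (f-preserves-maximum (decode m c))) (maximum-decode m c))

    fCode-encode : ∀ m X → maximum X ≤ m → fCode m (encode m X) ≡ encode m (f X)
    fCode-encode m X maxX≤m = encode-cong m (f (decode m (encode m X))) (f X)
      (f-cong {decode m (encode m X)} {X} (decode-encode m X maxX≤m))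

    injective⇒surjective : Injective _≈_ _≈_ f → Surjective _≈_ _≈_ f
    injective⇒surjective inj Y = decode k c , λ {Z} Z≈ → begin
      f Z                   ≈⟨ f-cong {Z} {decode k c} Z≈ ⟩
      f (decode k c)        ≈⟨ decode-fCode k c ⟨
      decode k (fCode k c)  ≡⟨ cong (decode k) (proj₂ preimage) ⟩
      decode k (encode k Y) ≈⟨ decode-encode k Y ≤-refl ⟩
      Y                     ∎
      where
      open ≈-Reasoning
      -- The least bound for which the target `Y` is recovered from its code.
      k = maximum Y
      fCode-injective : Injective _≡_ _≡_ (fCode k)
      fCode-injective {c} {d} eq = decode-injective k c d (inj {decode k c} {decode k d} (begin
        f (decode k c)       ≈⟨ decode-fCode k c ⟨
        decode k (fCode k c) ≡⟨ cong (decode k) eq ⟩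
        decode k (fCode k d) ≈⟨ decode-fCode k d ⟩
        f (decode k d)       ∎))
      preimage : ∃ λ c → fCode k c ≡ encode k Y
      preimage = injective⇒strictlySurjective fCode-injective (encode k Y)
      c = proj₁ preimage

    surjective⇒injective : Surjective _≈_ _≈_ f → Injective _≈_ _≈_ f
    surjective⇒injective surj {X} {Y} fX≈fY = begin
      X                     ≈⟨ decode-encode k X (m≤m⊔n _ _) ⟨
      decode k (encode k X) ≡⟨ cong (decode k) codes≡ ⟩
      decode k (encode k Y) ≈⟨ decode-encode k Y (m≤n⊔m (maximum X) _) ⟩
      Y                     ∎
      where
      open ≈-Reasoning
      -- A common bound lets one finite type code both sets faithfully.
      k = maximum X ⊔ maximum Y
      fCode-surjective : StrictlySurjective _≡_ (fCode k)
      fCode-surjective c with surj (decode k c)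
      ... | Z , fZ≈ = encode k Z , trans (fCode-encode k Z maxZ≤k)
              (trans (encode-cong k (f Z) (decode k c) fZ≈c) (encode-decode k c))
        where
        fZ≈c : f Z ≈ decode k c
        fZ≈c = fZ≈ {Z} (≈-refl {Z})
        -- Surjectivity alone puts no bound on the preimage `Z`; as `f` preserves maxima, `Z`
        -- inherits the bound of its image.
        maxZ≤k : maximum Z ≤ k
        maxZ≤k = subst (_≤ k)
          (trans (sym (maximum-cong (f Z) (decode k c) fZ≈c)) (f-preserves-maximum Z))
          (maximum-decode k c)
      codes≡ : encode k X ≡ encode k Y
      codes≡ = strictlySurjective⇒injective fCode-surjective
        (trans (fCode-encode k X (m≤m⊔n _ _))
          (trans (encode-cong k (f X) (f Y) fX≈fY)
            (sym (fCode-encode k Y (m≤n⊔m (maximum X) _)))))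

theorem2p5 : (f : 𝒫fin,0 → 𝒫fin,0) → IsEndomorphism f →
    ((Injective _≈_ _≈_ f × f ⟦0,1⟧ ≈ ⟦0,1⟧) ⇔ Surjective _≈_ _≈_ f)
    × (Surjective _≈_ _≈_ f ⇔ IsAutomorphism f)
theorem2p5 f f-endo = mk⇔ a⇒b b⇒a , mk⇔ b⇒c MonoidMorphisms.IsMonoidIsomorphism.surjective
  where
  open Endomorphism f f-endo
  a⇒b : Injective _≈_ _≈_ f × f ⟦0,1⟧ ≈ ⟦0,1⟧ → Surjective _≈_ _≈_ f
  a⇒b (inj , f⟦0,1⟧≈⟦0,1⟧) = injective⇒surjective f⟦0,1⟧≈⟦0,1⟧ inj
  b⇒a : Surjective _≈_ _≈_ f → Injective _≈_ _≈_ f × f ⟦0,1⟧ ≈ ⟦0,1⟧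
  b⇒a surj =
    -- The finite reduction behind injectivity presupposes that `⟦0,1⟧` is fixed, so this is derived
    -- from surjectivity first.
    surjective⇒injective (surjective⇒preserves-⟦0,1⟧ surj) surj , surjective⇒preserves-⟦0,1⟧ surj
  b⇒c : Surjective _≈_ _≈_ f → IsAutomorphism f
  b⇒c surj = record
    { isMonoidMonomorphism = record
      { isMonoidHomomorphism = f-endo
      ; injective            = proj₁ (b⇒a surj)
      }
    ; surjective = surj
    }
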